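{- Let $m>0$ and $k\ge 0$ be integers. Then $$(R_mC_mR_m)^k=R_mC_m^k .$$
   Context: For an integer $m>0$, $C_m$ is the $m\times m$ circulant matrix whose $(i,j)$ entry ($0\le i,j\le m-1$) is the residue of $i-j$ modulo $m$ in $\{0,1,\dots,m-1\}$; so its first row is $(0,m-1,m-2,\dots,2,1)$, its first column is $(0,1,\dots,m-1)^T$, and each row is the cyclic shift to the right of the preceding one. $R_m$ is the $m\times m$ matrix given in block form by $$R_m=\begin{pmatrix} I_{m-1} & -\mathbf{1}\\ 0 & 0\end{pmatrix},$$ where $I_{m-1}$ is the identity matrix of size $m-1$, $\mathbf 1$ is the column vector of length $m-1$ with all entries $1$, and the last row is zero (for $m=1$, $R_1$ is the $1\times 1$ zero matrix).
   Formalization: The identity is stated for k ≥ 1 instead of k ≥ 0: at k = 0 the left side is the identity matrix and the right side is R_m, whose last row is zero, so the claim fails for every m > 0. -}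

module Defs where

open import Data.Bool.Base using (if_then_else_)
open import Data.Fin.Base using (Fin; toℕ)
open import Data.Fin.Properties using (_≟_)
open import Data.Fin.Relation.Unary.Top using (View; view; ‵fromℕ; ‵inject₁)
open import Data.Integer.Base
  using (ℤ; +_; 0ℤ; 1ℤ; -1ℤ; _-_; _*_; _%ℕ_)
open import Data.Integer.Properties using (+-*-semiring)
open import Data.Nat.Base using (ℕ; zero; suc; NonZero)
open import Data.Vec.Functional using (Vector)
open import Relation.Binary.PropositionalEquality.Core using (_≡_)
open import Relation.Nullary.Decidable.Core using (does)

open import Algebra.Properties.Semiring.Sum +-*-semiring using (sum)

SquareMatrix : ℕ → Set
SquareMatrix m = Vector (Vector ℤ m) m

-- Entrywise equality: without function extensionality, `_≡_` is too strong
-- for matrices represented as functions.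
infix 4 _≋_
_≋_ : ∀ {m} → SquareMatrix m → SquareMatrix m → Set
A ≋ B = ∀ i j → A i j ≡ B i j

identity : ∀ m → SquareMatrix m
identity m i j = if does (i ≟ j) then 1ℤ else 0ℤ

infixl 7 _·_
_·_ : ∀ {m} → SquareMatrix m → SquareMatrix m → SquareMatrix m
(A · B) i j = sum (λ l → A i l * B l j)

infixr 8 _^_
_^_ : ∀ {m} → SquareMatrix m → ℕ → SquareMatrix m
A ^ zero  = identity _
A ^ suc k = A · (A ^ k)

-- `_%ℕ_` on integers is Euclidean: its value always lies in {0, …, m - 1},
-- also when i < j.
C : ∀ m .{{_ : NonZero m}} → SquareMatrix m
C m i j = + ((+ toℕ i - + toℕ j) %ℕ m)

-- `view` tells whether an index in Fin (suc n) is the last one (‵fromℕ) or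
-- comes from a : Fin n (‵inject₁), so the clauses below are the blocks
--   ( I_n  -1 )
--   (  0    0 ).
R : ∀ m .{{_ : NonZero m}} → SquareMatrix m
R (suc n) i j = block (view i) (view j)
  where
  block : ∀ {i j : Fin (suc n)} → View i → View j → ℤ
  block (‵inject₁ a) (‵inject₁ b) = identity n a b
  block (‵inject₁ _) ‵fromℕ       = -1ℤ
  block ‵fromℕ       _            = 0ℤ

{-# OPTIONS --safe #-}
-- Let 𝟏 be the all-ones column.  The rows of C m are cyclic shifts of one another,
-- so C m 𝟏 = s 𝟏 for a scalar s, while R m 𝟏 = 0; hence R m C m 𝟏 = 0.  For any A
-- with A 𝟏 = 0 one has A R m = A, so R C R = R C, and this collapses (R C R)^k to
-- R C^k for k ≥ 1.
module Submission where

open import Defs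
open import Data.Fin.Base using (Fin; zero; suc; toℕ; fromℕ; inject₁)
open import Data.Fin.Induction using (<-weakInduction)
open import Data.Fin.Properties using (toℕ-inject₁; toℕ-fromℕ; toℕ<n)
open import Data.Fin.Relation.Unary.Top
  using (View; view; view-fromℕ; view-inject₁; ‵fromℕ; ‵inject₁)
open import Data.Integer.Base
  using (ℤ; +_; -[1+_]; 0ℤ; 1ℤ; -1ℤ; -_; _+_; _-_; _*_; _%ℕ_; _⊖_)
open import Data.Integer.Properties
  using (+-*-semiring; +-identityˡ; +-identityʳ; +-comm; *-identityʳ
        ; *-zeroʳ; *-assoc; *-comm; -1*i≡-i; m-n≡m⊖n; [1+m]⊖[1+n]≡m⊖n; ⊖-<
        ; +-0-abelianGroup)
open import Data.Nat.Base as ℕ using (ℕ; zero; suc; NonZero; _≥_; _∸_)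
open import Data.Nat.DivMod using (m<n⇒m%n≡m)
import Data.Nat.Properties as ℕ
open import Data.Vec.Functional using (Vector; init; last)
open import Function.Base using (_∘_)
open import Relation.Binary.PropositionalEquality
  using (_≡_; refl; sym; trans; cong; cong₂; module ≡-Reasoning)

open import Algebra.Properties.AbelianGroup +-0-abelianGroup using (inverseʳ-unique)
open import Algebra.Properties.Semiring.Sum +-*-semiring
  using (sum; sum-cong-≗; sum-replicate-zero; sum-init-last; ∑-comm
        ; *-distribˡ-sum; *-distribʳ-sum)

open ≡-Reasoning

private
  variable
    n : ℕ

sum-zero : (x : Vector ℤ n) → (∀ i → x i ≡ 0ℤ) → sum x ≡ 0ℤ
sum-zero {n} x x≡0 = trans (sum-cong-≗ x≡0) (sum-replicate-zero n)

sum-*-identity : (x : Vector ℤ n) (j : Fin n) → sum (λ i → x i * identity n i j) ≡ x j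
sum-*-identity x zero = begin
  x zero * 1ℤ + sum (λ i → x (suc i) * 0ℤ)
    ≡⟨ cong₂ _+_ (*-identityʳ (x zero)) (sum-zero _ (*-zeroʳ ∘ x ∘ suc)) ⟩
  x zero + 0ℤ
    ≡⟨ +-identityʳ (x zero) ⟩
  x zero ∎
sum-*-identity {suc n} x (suc j) = begin
  x zero * 0ℤ + sum (λ i → x (suc i) * identity n i j)
    ≡⟨ cong₂ _+_ (*-zeroʳ (x zero)) (sum-*-identity (x ∘ suc) j) ⟩
  0ℤ + x (suc j)
    ≡⟨ +-identityˡ (x (suc j)) ⟩
  x (suc j) ∎

sum-identity : (i : Fin n) → sum (identity n i) ≡ 1ℤ
sum-identity {suc n} zero    = cong (_+_ 1ℤ) (sum-replicate-zero n)
sum-identity {suc n} (suc i) = trans (+-identityˡ _) (sum-identity i)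

≋-sym : {A B : SquareMatrix n} → A ≋ B → B ≋ A
≋-sym A≋B i j = sym (A≋B i j)

≋-trans : {A B D : SquareMatrix n} → A ≋ B → B ≋ D → A ≋ D
≋-trans A≋B B≋D i j = trans (A≋B i j) (B≋D i j)

·-congˡ : (A : SquareMatrix n) {B D : SquareMatrix n} → B ≋ D → A · B ≋ A · D
·-congˡ A B≋D i j = sum-cong-≗ (λ l → cong (A i l *_) (B≋D l j))

·-congʳ : {A B : SquareMatrix n} (D : SquareMatrix n) → A ≋ B → A · D ≋ B · D
·-congʳ D A≋B i j = sum-cong-≗ (λ l → cong (_* D l j) (A≋B i l))

·-assoc : (A B D : SquareMatrix n) → A · B · D ≋ A · (B · D)
·-assoc A B D i j = begin
  sum (λ l → sum (λ h → A i h * B h l) * D l j)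
    ≡⟨ sum-cong-≗ (λ l → *-distribʳ-sum (D l j) (λ h → A i h * B h l)) ⟩
  sum (λ l → sum (λ h → A i h * B h l * D l j))
    ≡⟨ ∑-comm (λ l h → A i h * B h l * D l j) ⟩
  sum (λ h → sum (λ l → A i h * B h l * D l j))
    ≡⟨ sum-cong-≗ (λ h → sum-cong-≗ (λ l → *-assoc (A i h) (B h l) (D l j))) ⟩
  sum (λ h → sum (λ l → A i h * (B h l * D l j)))
    ≡⟨ sum-cong-≗ (λ h → *-distribˡ-sum (A i h) (λ l → B h l * D l j)) ⟨
  sum (λ h → A i h * sum (λ l → B h l * D l j)) ∎

·-identityʳ : (A : SquareMatrix n) → A · identity n ≋ A
·-identityʳ A i = sum-*-identity (A i)

-- The row sums of a matrix are the entries of its product with 𝟏, so this is (A B) 𝟏 = A (B 𝟏)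
-- phrased without column vectors.
sum-row-· : (A B : SquareMatrix n) (i : Fin n) →
            sum ((A · B) i) ≡ sum (λ l → A i l * sum (B l))
sum-row-· A B i = begin
  sum (λ j → sum (λ l → A i l * B l j)) ≡⟨ ∑-comm (λ j l → A i l * B l j) ⟩
  sum (λ l → sum (λ j → A i l * B l j))
    ≡⟨ sum-cong-≗ (λ l → *-distribˡ-sum (A i l) (B l)) ⟨
  sum (λ l → A i l * sum (B l)) ∎

-- `R` reduces only once `view` of an index is a constructor; rewriting by the computation rules of
-- `view` exposes the block.
R-inject₁-inject₁ : (a b : Fin n) → R (suc n) (inject₁ a) (inject₁ b) ≡ identity n a b
R-inject₁-inject₁ a b rewrite view-inject₁ a | view-inject₁ b = refl

R-inject₁-fromℕ : (a : Fin n) → R (suc n) (inject₁ a) (fromℕ n) ≡ -1ℤ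
R-inject₁-fromℕ {n} a rewrite view-inject₁ a | view-fromℕ n = refl

R-fromℕ : (j : Fin (suc n)) → R (suc n) (fromℕ n) j ≡ 0ℤ
R-fromℕ {n} j rewrite view-fromℕ n = refl

-- This is R 𝟏 = 0: in each row above the last, the single 1 of the identity block cancels the final
-- -1.
sum-row-R : (i : Fin (suc n)) → sum (R (suc n) i) ≡ 0ℤ
sum-row-R {n} i = go (view i)
  where
  go : ∀ {i} → View i → sum (R (suc n) i) ≡ 0ℤ
  go ‵fromℕ = sum-zero (R (suc n) (fromℕ n)) R-fromℕ
  go (‵inject₁ a) = begin
    sum r                     ≡⟨ sum-init-last r ⟩
    sum (init r) + last r
      ≡⟨ cong₂ _+_ (sum-cong-≗ (R-inject₁-inject₁ a)) (R-inject₁-fromℕ a) ⟩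
    sum (identity n a) + -1ℤ  ≡⟨ cong (_+ -1ℤ) (sum-identity a) ⟩
    0ℤ                        ∎
    where r = R (suc n) (inject₁ a)

sum-*-R : (x : Vector ℤ (suc n)) (j : Fin (suc n)) →
          sum (λ l → x l * R (suc n) l j) ≡ sum (λ l → init x l * R (suc n) (inject₁ l) j)
sum-*-R {n} x j = begin
  sum (λ l → x l * R (suc n) l j)
    ≡⟨ sum-init-last (λ l → x l * R (suc n) l j) ⟩
  s + last x * R (suc n) (fromℕ n) j
    ≡⟨ cong (λ r → s + last x * r) (R-fromℕ j) ⟩
  s + last x * 0ℤ
    ≡⟨ cong (_+_ s) (*-zeroʳ (last x)) ⟩
  s + 0ℤ
    ≡⟨ +-identityʳ s ⟩
  s ∎
  where s = sum (λ l → init x l * R (suc n) (inject₁ l) j)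

-- Right multiplication by `R` keeps every column but the last, which it replaces by minus the sum
-- of the others. When the rows sum to zero, that is the old last column.
·-R : (A : SquareMatrix (suc n)) → (∀ i → sum (A i) ≡ 0ℤ) → A · R (suc n) ≋ A
·-R {n} A A𝟏≡0 i j = go (view j)
  where
  go : ∀ {j} → View j → (A · R (suc n)) i j ≡ A i j
  go (‵inject₁ b) = begin
    (A · R (suc n)) i (inject₁ b)
      ≡⟨ sum-*-R (A i) (inject₁ b) ⟩
    sum (λ l → init (A i) l * R (suc n) (inject₁ l) (inject₁ b))
      ≡⟨ sum-cong-≗ (λ l → cong (init (A i) l *_) (R-inject₁-inject₁ l b)) ⟩
    sum (λ l → init (A i) l * identity n l b)
      ≡⟨ sum-*-identity (init (A i)) b ⟩
    A i (inject₁ b) ∎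
  go ‵fromℕ = begin
    (A · R (suc n)) i (fromℕ n)
      ≡⟨ sum-*-R (A i) (fromℕ n) ⟩
    sum (λ l → init (A i) l * R (suc n) (inject₁ l) (fromℕ n))
      ≡⟨ sum-cong-≗ (λ l → cong (init (A i) l *_) (R-inject₁-fromℕ l)) ⟩
    sum (λ l → init (A i) l * -1ℤ)
      ≡⟨ *-distribʳ-sum -1ℤ (init (A i)) ⟨
    sum (init (A i)) * -1ℤ
      ≡⟨ *-comm (sum (init (A i))) -1ℤ ⟩
    -1ℤ * sum (init (A i))
      ≡⟨ -1*i≡-i (sum (init (A i))) ⟩
    - sum (init (A i))
      ≡⟨ inverseʳ-unique _ _ (trans (sym (sum-init-last (A i))) (A𝟏≡0 i)) ⟨
    A i (fromℕ n) ∎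

-- On a negative argument `_%ℕ_` branches on whether the remainder of the absolute value is zero.
-- The strict bound makes that remainder `suc n`, which selects the nonzero branch.
-[1+n]%ℕd≡d∸[1+n] : ∀ n d .{{_ : NonZero d}} → suc n ℕ.< d → -[1+ n ] %ℕ d ≡ d ∸ suc n
-[1+n]%ℕd≡d∸[1+n] n d 1+n<d rewrite m<n⇒m%n≡m 1+n<d = refl

C-suc-suc : (i j : Fin n) → C (suc n) (suc i) (suc j) ≡ C (suc n) (inject₁ i) (inject₁ j)
C-suc-suc {n} i j rewrite toℕ-inject₁ i | toℕ-inject₁ j =
  cong (λ z → + (z %ℕ suc n)) (begin
    -- The difference of two successors already reduces to `_⊖_`; the unshifted one is stuck on
    -- `toℕ j` and needs `m-n≡m⊖n`.
    suc (toℕ i) ⊖ suc (toℕ j) ≡⟨ [1+m]⊖[1+n]≡m⊖n (toℕ i) (toℕ j) ⟩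
    toℕ i ⊖ toℕ j             ≡⟨ m-n≡m⊖n (toℕ i) (toℕ j) ⟨
    + toℕ i - + toℕ j         ∎)

[m-n]%ℕ[1+n]≡1+m : ∀ {m n} → m ℕ.< n → (+ m - + n) %ℕ suc n ≡ suc m
[m-n]%ℕ[1+n]≡1+m {m} {n} m<n with n ∸ m in eq | ℕ.m<n⇒0<n∸m m<n
-- Positivity of `n ∸ m` excludes zero, and naming it `suc r` lets its negation compute to
-- `-[1+ r ]`.
... | suc r | _ = begin
  (+ m - + n) %ℕ suc n ≡⟨ cong (_%ℕ suc n) (trans (m-n≡m⊖n m n) (⊖-< m<n)) ⟩
  (- + (n ∸ m)) %ℕ suc n ≡⟨ cong (λ d → (- + d) %ℕ suc n) eq ⟩
  -[1+ r ] %ℕ suc n    ≡⟨ -[1+n]%ℕd≡d∸[1+n] r (suc n) (ℕ.s≤s 1+r≤n) ⟩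
  suc n ∸ suc r        ≡⟨ cong (suc n ∸_) eq ⟨
  suc n ∸ (n ∸ m)      ≡⟨ ℕ.+-∸-assoc 1 (ℕ.m∸n≤m n m) ⟩
  suc (n ∸ (n ∸ m))    ≡⟨ cong suc (ℕ.m∸[m∸n]≡n (ℕ.<⇒≤ m<n)) ⟩
  suc m                ∎
  where
  1+r≤n : suc r ℕ.≤ n
  1+r≤n = ℕ.≤-trans (ℕ.≤-reflexive (sym eq)) (ℕ.m∸n≤m n m)

-- The wrap-around entry: the differences i + 1 and i - n differ by exactly the modulus n + 1.
C-suc-zero : (i : Fin n) → C (suc n) (suc i) zero ≡ C (suc n) (inject₁ i) (fromℕ n)
C-suc-zero {n} i rewrite toℕ-inject₁ i | toℕ-fromℕ n | ℕ.+-identityʳ (toℕ i) = cong +_ (begin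
  suc (toℕ i) ℕ.% suc n       ≡⟨ m<n⇒m%n≡m (ℕ.s≤s (toℕ<n i)) ⟩
  suc (toℕ i)                 ≡⟨ [m-n]%ℕ[1+n]≡1+m (toℕ<n i) ⟨
  (+ toℕ i - + n) %ℕ suc n    ∎)

-- A cyclic shift to the right moves the last entry to the front, so only the order of summation
-- changes.
sum-row-C-suc : (i : Fin n) → sum (C (suc n) (suc i)) ≡ sum (C (suc n) (inject₁ i))
sum-row-C-suc {n} i = begin
  c′ zero + sum (c′ ∘ suc) ≡⟨ cong₂ _+_ (C-suc-zero i) (sum-cong-≗ (C-suc-suc i)) ⟩
  last c + sum (init c)    ≡⟨ +-comm (last c) (sum (init c)) ⟩
  sum (init c) + last c    ≡⟨ sum-init-last c ⟨
  sum c                    ∎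
  where
  c′ = C (suc n) (suc i)
  c  = C (suc n) (inject₁ i)

sum-row-C : (i : Fin (suc n)) → sum (C (suc n) i) ≡ sum (C (suc n) zero)
sum-row-C {n} = <-weakInduction (λ i → sum (C (suc n) i) ≡ sum (C (suc n) zero)) refl
  (λ i → trans (sum-row-C-suc i))

sum-row-RC : (i : Fin (suc n)) → sum ((R (suc n) · C (suc n)) i) ≡ 0ℤ
sum-row-RC {n} i = begin
  sum ((R (suc n) · C (suc n)) i)           ≡⟨ sum-row-· (R (suc n)) (C (suc n)) i ⟩
  sum (λ l → R (suc n) i l * sum (C (suc n) l))
    ≡⟨ sum-cong-≗ (λ l → cong (R (suc n) i l *_) (sum-row-C l)) ⟩
  sum (λ l → R (suc n) i l * s)             ≡⟨ *-distribʳ-sum s (R (suc n) i) ⟨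
  sum (R (suc n) i) * s                     ≡⟨ cong (_* s) (sum-row-R i) ⟩
  0ℤ                                        ∎
  where s = sum (C (suc n) zero)

-- In the inductive step (P A P)(P A^k) = (P A)(P A^k) = (P A P) A^k = (P A) A^k, so the hypothesis
-- serves twice. Exponents start at 1, since at 0 the two sides would be the identity and P.
^-collapse : (P A : SquareMatrix n) → P · A · P ≋ P · A →
             ∀ k → (P · A · P) ^ suc k ≋ P · A ^ suc k
^-collapse P A PAP≋PA zero =
  ≋-trans (·-identityʳ (P · A · P))
  (≋-trans PAP≋PA (·-congˡ P (≋-sym (·-identityʳ A))))
^-collapse P A PAP≋PA (suc k) =
  ≋-trans (·-congˡ (P · A · P) (^-collapse P A PAP≋PA k))
  (≋-trans (·-congʳ (P · A ^ suc k) PAP≋PA)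
  (≋-trans (≋-sym (·-assoc (P · A) P (A ^ suc k)))
  (≋-trans (·-congʳ (A ^ suc k) PAP≋PA)
  (·-assoc P A (A ^ suc k)))))

mainTheorem6 : ∀ (m : ℕ) .{{_ : NonZero m}} (k : ℕ) → k ≥ 1 →
    (R m · C m · R m) ^ k ≋ R m · C m ^ k
mainTheorem6 (suc n) (suc k) _ =
  -- As `_·_` associates to the left, `·-R` applied to R C is literally the required R C R = R C.
  ^-collapse (R (suc n)) (C (suc n)) (·-R (R (suc n) · C (suc n)) sum-row-RC) k
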